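{- For every positive integer $n$, the complete graph $K_n$ satisfies $\mu(K_n)=n$.
   Context: Let $G$ be a finite simple graph on the vertex set $\{1,\dots,n\}$ and let $\Gamma$ be a finite set of colors. A strategy for vertex $i$ is a function $F_i:\Gamma^n\to\Gamma$ whose value $F_i(x_1,\dots,x_n)$ depends only on those coordinates $x_j$ for which $j$ is adjacent to $i$ in $G$. A system of strategies $(F_1,\dots,F_n)$ is winning if for every $(x_1,\dots,x_n)\in\Gamma^n$ there is at least one $i$ with $F_i(x_1,\dots,x_n)=x_i$. The hat chromatic number $\mu(G)$ is the largest integer $k=|\Gamma|$ for which a winning system of strategies exists on $G$. -}

module Defs where

open import Data.Fin.Base using (Fin)
open import Data.Fin.Properties using (_≟_)
open import Data.Nat.Base using (ℕ; _≤_)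
open import Data.Nat.Properties using (≤-antisym)
open import Data.Product.Base using (Σ-syntax; ∃-syntax; _×_; _,_)
open import Data.Vec.Functional using (Vector)
open import Level using (0ℓ)
open import Relation.Binary.Core using (Rel)
open import Relation.Binary.Definitions using (Symmetric; Irreflexive; Decidable)
open import Relation.Binary.PropositionalEquality using (_≡_; _≢_; ≢-sym)
open import Relation.Nullary.Decidable using (¬?)

record SimpleGraph (n : ℕ) : Set₁ where
  field
    Adj    : Rel (Fin n) 0ℓ
    adj?   : Decidable Adj
    sym    : Symmetric Adj
    irrefl : Irreflexive _≡_ Adj

open SimpleGraph public using (Adj)

K : (n : ℕ) → SimpleGraph n
K n = record
  { Adj    = _≢_
  ; adj?   = λ i j → ¬? (i ≟ j)
  ; sym    = ≢-sym
  ; irrefl = λ i≡j i≢j → i≢j i≡j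
  }

record Strategy {n : ℕ} (G : SimpleGraph n) (Γ : Set) (i : Fin n) : Set where
  field
    guess : Vector Γ n → Γ
    -- In particular guess respects pointwise equality of colourings, so no
    -- function extensionality is needed to treat Vector Γ n as Γⁿ.
    local : ∀ x y → (∀ j → Adj G i j → x j ≡ y j) → guess x ≡ guess y

open Strategy public

StrategySystem : {n : ℕ} → SimpleGraph n → Set → Set
StrategySystem {n} G Γ = (i : Fin n) → Strategy G Γ i

Winning : {n : ℕ} {G : SimpleGraph n} {Γ : Set} → StrategySystem G Γ → Set
Winning {n} {Γ = Γ} F = (x : Vector Γ n) → ∃[ i ] guess (F i) x ≡ x i

-- Only the cardinality of the set of colours matters, so Fin k serves as the
-- set with k colours.
Winnable : {n : ℕ} → SimpleGraph n → ℕ → Set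
Winnable G k = Σ[ F ∈ StrategySystem G (Fin k) ] Winning F

-- μ(G) = k.  A relation rather than a function of G: the graph on no vertices
-- has no winning system for any k, so μ is not total.
IsHatChromaticNumber : {n : ℕ} → SimpleGraph n → ℕ → Set
IsHatChromaticNumber G k = Winnable G k × (∀ m → Winnable G m → m ≤ k)

hatChromaticNumber-unique : {n : ℕ} (G : SimpleGraph n) {k l : ℕ} →
  IsHatChromaticNumber G k → IsHatChromaticNumber G l → k ≡ l
hatChromaticNumber-unique G (wₖ , maxₖ) (wₗ , maxₗ) =
  ≤-antisym (maxₗ _ wₖ) (maxₖ _ wₗ)

{-# OPTIONS --safe #-}
-- Upper bound, for any graph on n vertices: a colouring is determined by a
-- vertex i that guesses correctly together with the colours of the others, so
-- a winning system with m colours gives mⁿ ≤ n · mⁿ⁻¹.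
-- Lower bound: vertex i of K n guesses as if the sum of all colours were
-- i mod n; exactly one vertex is right.
module Submission where

open import Defs
open import Data.Nat.Base using (ℕ; NonZero)

open import Data.Fin.Base
  using (Fin; zero; suc; toℕ; combine; punchIn; punchOut; finToFun; funToFin)
open import Data.Fin.Properties
  using (_≟_; combine-injective; finToFun-funToFin; funToFin-finToFin; injective⇒≤;
         punchIn-punchOut; punchInᵢ≢i; toℕ-fromℕ<; toℕ-injective; toℕ<n)
open import Data.Nat.Base using (zero; suc; _+_; _*_; _^_; _≤_; z≤n)
open import Data.Nat.DivMod
  using (_%_; _mod_; m%n<n; m<n⇒m%n≡m; [m+kn]%n≡m%n; %-distribˡ-+; m%n%n≡m%n)
open import Data.Nat.Properties
  using (*-cancelʳ-≤; *-comm; +-0-commutativeMonoid; +-assoc; m^n≢0)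
open import Data.Product.Base using (_,_; proj₁; proj₂)
open import Data.Vec.Functional using (Vector; removeAt)
open import Function.Base using (_∘_)
open import Function.Definitions using (Injective)
open import Relation.Binary.PropositionalEquality
  using (_≡_; _≢_; _≗_; refl; sym; trans; cong; cong₂; subst; ≢-sym; module ≡-Reasoning)
open import Relation.Nullary using (yes; no)

open import Algebra.Properties.CommutativeMonoid.Sum +-0-commutativeMonoid
  using (sum; sum-cong-≗; sum-remove)

funToFin-cong : ∀ {m n} {f g : Fin m → Fin n} → f ≗ g → funToFin f ≡ funToFin g
funToFin-cong {zero}  f≗g = refl
funToFin-cong {suc m} f≗g = cong₂ combine (f≗g zero) (funToFin-cong (f≗g ∘ suc))

funToFin-injective : ∀ {m n} {f g : Fin m → Fin n} → funToFin f ≡ funToFin g → f ≗ g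
funToFin-injective {f = f} {g} eq j = begin
  f j                      ≡⟨ finToFun-funToFin f j ⟨
  finToFun (funToFin f) j  ≡⟨ cong (λ c → finToFun c j) eq ⟩
  finToFun (funToFin g) j  ≡⟨ finToFun-funToFin g j ⟩
  g j                      ∎
  where open ≡-Reasoning

-- Codes stand in for colourings in the count: pointwise agreement of colourings becomes `≡` of
-- codes, without function extensionality.
finToFun-injective : ∀ {m n} {c d : Fin (n ^ m)} → finToFun {n} {m} c ≗ finToFun d → c ≡ d
finToFun-injective {m} {n} {c} {d} eq = begin
  c                               ≡⟨ funToFin-finToFin {m} {n} c ⟨
  funToFin (finToFun {n} {m} c)   ≡⟨ funToFin-cong eq ⟩
  funToFin (finToFun {n} {m} d)   ≡⟨ funToFin-finToFin {m} {n} d ⟩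
  d                               ∎
  where open ≡-Reasoning

removeAt-≗⇒≡ : ∀ {n} {A : Set} {x y : Vector A (suc n)} {i} →
  removeAt x i ≗ removeAt y i → ∀ j → i ≢ j → x j ≡ y j
removeAt-≗⇒≡ {x = x} {y} eq j i≢j =
  subst (λ l → x l ≡ y l) (punchIn-punchOut i≢j) (eq (punchOut i≢j))

module _ {n : ℕ} {G : SimpleGraph (suc n)} {Γ : Set} (F : StrategySystem G Γ) where

  -- By irreflexivity vertex `i` does not see itself, so agreement off `i` forces equal guesses; as
  -- both are correct, the colours at `i` agree too.
  correct-unique : ∀ {i x y} → guess (F i) x ≡ x i → guess (F i) y ≡ y i →
    removeAt x i ≗ removeAt y i → x ≗ y
  correct-unique {i} {x} {y} px py eq j with i ≟ j
  ... | no  i≢j  = removeAt-≗⇒≡ {x = x} {y} eq j i≢j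
  ... | yes refl = begin
    x i            ≡⟨ px ⟨
    guess (F i) x  ≡⟨ local (F i) x y agree ⟩
    guess (F i) y  ≡⟨ py ⟩
    y i            ∎
    where
    open ≡-Reasoning
    agree : ∀ l → Adj G i l → x l ≡ y l
    agree l il = removeAt-≗⇒≡ {x = x} {y} eq l (λ i≡l → SimpleGraph.irrefl G i≡l il)

winnable⇒≤ : ∀ {n} (G : SimpleGraph (suc n)) m → Winnable G m → m ≤ suc n
winnable⇒≤ G zero _ = z≤n
winnable⇒≤ {n} G m@(suc _) (F , win) =
  -- `m ^ suc n` unfolds to `m * m ^ n`, so the common factor cancels; it is nonzero because `m` is
  -- a successor here.
  *-cancelʳ-≤ m (suc n) (m ^ n) {{m^n≢0 m n}} (injective⇒≤ encode-injective)
  where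
  colouring : Fin (m ^ suc n) → Vector (Fin m) (suc n)
  colouring = finToFun

  winner : Fin (m ^ suc n) → Fin (suc n)
  winner c = proj₁ (win (colouring c))

  others : Fin (m ^ suc n) → Fin (m ^ n)
  others c = funToFin (removeAt (colouring c) (winner c))

  encode : Fin (m ^ suc n) → Fin (suc n * m ^ n)
  encode c = combine (winner c) (others c)

  encode-injective : Injective _≡_ _≡_ encode
  encode-injective {c} {d} eq
    -- Abstracting both results turns the winners into variables, so that their equality can be
    -- matched with `refl`.
    with win (colouring c) | win (colouring d)
  ... | i , pc | j , pd
    with combine-injective i (funToFin (removeAt (colouring c) i))
                           j (funToFin (removeAt (colouring d) j)) eq
  ... | refl , eq′ =
    finToFun-injective {suc n} {m} (correct-unique F pc pd (funToFin-injective eq′))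

toℕ-mod : ∀ a n .{{_ : NonZero n}} → toℕ (a mod n) ≡ a % n
toℕ-mod a n = toℕ-fromℕ< (m%n<n a n)

%-+-congˡ : ∀ a b c n .{{_ : NonZero n}} → a % n ≡ b % n → (a + c) % n ≡ (b + c) % n
%-+-congˡ a b c n eq = begin
  (a + c) % n            ≡⟨ %-distribˡ-+ a c n ⟩
  (a % n + c % n) % n    ≡⟨ cong (λ r → (r + c % n) % n) eq ⟩
  (b % n + c % n) % n    ≡⟨ %-distribˡ-+ b c n ⟨
  (b + c) % n            ∎
  where open ≡-Reasoning

module _ (k : ℕ) where

  private
    n = suc k

  total : ∀ {l} → Vector (Fin n) l → ℕ
  total x = sum (toℕ ∘ x)

  -- k ≡ -1 mod n, so this is i minus the sum of the other colours, without
  -- truncated subtraction.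
  sumStrategy : StrategySystem (K n) (Fin n)
  sumStrategy i = record
    { guess = λ x → (toℕ i + k * total (removeAt x i)) mod n
    ; local = λ x y eq → cong (λ s → (toℕ i + k * s) mod n)
        -- The summands are colours at vertices `punchIn i j`, all distinct from `i` and hence
        -- adjacent to it.
        (sum-cong-≗ λ j → cong toℕ (eq (punchIn i j) (≢-sym (punchInᵢ≢i i j))))
    }

  -- The winner is the vertex whose assumed value of the sum is the true one. Modulo `n` its guess
  -- is the total minus the other colours, which is its own colour.
  sumStrategy-winning : Winning sumStrategy
  sumStrategy-winning x = i , toℕ-injective (begin
    toℕ ((toℕ i + k * s) mod n)  ≡⟨ toℕ-mod (toℕ i + k * s) n ⟩
    (toℕ i + k * s) % n          ≡⟨ %-+-congˡ (toℕ i) (total x) (k * s) n i≡total ⟩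
    (total x + k * s) % n        ≡⟨ cong (λ t → (t + k * s) % n)
                                      (sum-remove {i = i} (toℕ ∘ x)) ⟩
    (toℕ (x i) + s + k * s) % n  ≡⟨ cong (_% n) (+-assoc (toℕ (x i)) s (k * s)) ⟩
    -- Since `n` is `suc k`, `s + k * s` is `n * s` by definition, a multiple of the modulus.
    (toℕ (x i) + n * s) % n      ≡⟨ cong (λ t → (toℕ (x i) + t) % n) (*-comm n s) ⟩
    (toℕ (x i) + s * n) % n      ≡⟨ [m+kn]%n≡m%n (toℕ (x i)) s n ⟩
    toℕ (x i) % n                ≡⟨ m<n⇒m%n≡m (toℕ<n (x i)) ⟩
    toℕ (x i)                    ∎)
    where
    open ≡-Reasoning
    i = total x mod n
    s = total (removeAt x i)
    i≡total : toℕ i % n ≡ total x % n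
    i≡total = trans (cong (_% n) (toℕ-mod (total x) n)) (m%n%n≡m%n (total x) n)

theorem1 : (n : ℕ) .{{_ : NonZero n}} → IsHatChromaticNumber (K n) n
theorem1 (suc k) = (sumStrategy k , sumStrategy-winning k) , winnable⇒≤ (K (suc k))
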